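{- Let $d\geq 1$. If $\varphi$ is a partial proper $d$-edge coloring of $Q_d$ in which every color appears on at most $d-2$ edges, then $\varphi$ is avoidable.
   Context: $Q_d$ is the $d$-dimensional hypercube. A partial proper $d$-edge coloring assigns colors from $\{1,\dots,d\}$ to some edges so that adjacent colored edges receive different colors; it is avoidable if there is a proper $d$-edge coloring $f$ of $Q_d$ with colors $1,\dots,d$ such that $f(e)\neq\varphi(e)$ for every colored edge $e$. -}

module Defs where

open import Data.Bool using (Bool; true; false)
open import Data.Bool.Properties using () renaming (_≟_ to _≟ᵇ_)
open import Data.Fin using (Fin)
open import Data.Fin.Properties using () renaming (_≟_ to _≟ᶠ_)
open import Data.List as List using (List; []; _∷_; concatMap; mapMaybe; filter; length)
open import Data.Maybe using (Maybe; just; nothing)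
open import Data.Maybe.Properties using (≡-dec)
open import Data.Nat using (ℕ; zero; suc; _+_; _≤_)
open import Data.Product using (Σ; _×_; _,_; proj₁)
open import Data.Vec as Vec using (Vec; []; _∷_; lookup; _[_]≔_)
open import Data.Vec.Properties using (lookup∘update)
open import Relation.Binary.PropositionalEquality using (_≡_; _≢_)
open import Relation.Nullary using (yes; no)

Vertex : ℕ → Set
Vertex d = Vec Bool d

-- An edge of Q_d is {v, v with coordinate i flipped}; we represent it
-- canonically by its lower endpoint v (with v_i = 0, i.e. false) and its direction i.
Edge : ℕ → Set
Edge d = Σ (Vertex d × Fin d) (λ { (v , i) → lookup v i ≡ false })

edgeAt : ∀ {d} → Vertex d → Fin d → Edge d
edgeAt v i = ((v [ i ]≔ false) , i) , lookup∘update i v false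

allVertices : ∀ d → List (Vertex d)
allVertices zero = [] ∷ []
allVertices (suc d) = concatMap (λ v → (false ∷ v) ∷ (true ∷ v) ∷ []) (allVertices d)

allEdges : ∀ d → List (Edge d)
allEdges d = concatMap (λ v → mapMaybe (mk v) (List.allFin d)) (allVertices d)
  where
  mk : Vertex d → Fin d → Maybe (Edge d)
  mk v i with lookup v i ≟ᵇ false
  ... | yes p = just ((v , i) , p)
  ... | no _ = nothing

PartialColoring : ℕ → Set
PartialColoring d = Edge d → Maybe (Fin d)

IsProperPartial : ∀ {d} → PartialColoring d → Set
IsProperPartial {d} φ = ∀ (v : Vertex d) (i j : Fin d) (a b : Fin d) → i ≢ j →
  φ (edgeAt v i) ≡ just a → φ (edgeAt v j) ≡ just b → a ≢ b

Coloring : ℕ → Set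
Coloring d = Edge d → Fin d

IsProper : ∀ {d} → Coloring d → Set
IsProper {d} f = ∀ (v : Vertex d) (i j : Fin d) → i ≢ j →
  f (edgeAt v i) ≢ f (edgeAt v j)

colorCount : ∀ {d} → PartialColoring d → Fin d → ℕ
colorCount {d} φ c = length (filter (λ e → ≡-dec _≟ᶠ_ (φ e) (just c)) (allEdges d))

Avoidable : ∀ {d} → PartialColoring d → Set
Avoidable {d} φ = Σ (Coloring d) λ f → IsProper f ×
  (∀ (e : Edge d) (c : Fin d) → φ e ≡ just c → f e ≢ c)

{-# OPTIONS --safe #-}

-- Pair up the directions and pair up the colours, and give each pair of directions a
-- pair of colours. The two directions of a pair cut the cube into disjoint 4-cycles,
-- each of which can be coloured alternately in two ways; since φ is proper, both ways
-- fail only if two opposite edges of the 4-cycle carry exactly the two colours.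
-- For n = 2h + 2 directions and colours, let the pairings run through a round of a
-- round-robin tournament of the directions, a round for the colours, and a rotation:
-- n(n-1)²/2 configurations, of which such a bad 4-cycle spoils exactly one. Counting
-- each bad 4-cycle twice, as a flag (coloured edge, translation direction), there are
-- at most n(n-2)(n-1) < n(n-1)² flags when d = n is even, so some configuration works.
-- If d = n + 1 is odd, one direction i₀ is coloured entirely by a colour c₀ that φ does
-- not use in that direction. This leaves at most n(n-1)(n-1) candidate flags, and i₀, c₀
-- can be chosen so that one of the candidates is not a flag.
module Submission where

open import Defs
open import Axiom.UniquenessOfIdentityProofs using (module Decidable⇒UIP)
open import Data.Bool using (Bool; true; false; not; _xor_)
open import Data.Bool.Properties using () renaming (_≟_ to _≟ᵇ_)
open import Data.Empty using (⊥)
open import Data.Fin using (Fin; zero; suc; toℕ; combine; punchIn; punchOut; inject≤)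
open import Data.Fin.Properties using (suc-injective; toℕ<n; toℕ-injective; toℕ-fromℕ<; combine-injective; *↔×; 2↔Bool; injective⇒≤; inject≤-injective; any?; punchIn-injective; punchInᵢ≢i; punchIn-punchOut; punchOut-injective) renaming (_≟_ to _≟ᶠ_)
open import Data.List as List using (List; mapMaybe; concatMap; filter; allFin)
open import Data.List.Membership.Propositional using (_∈_; lose)
open import Data.List.Membership.Propositional.Properties using (∈-concatMap⁺; ∈-filter⁺; ∈-allFin)
open import Data.List.Relation.Unary.Any using (here; there; index)
open import Data.List.Relation.Unary.Any.Properties using (lookup-index)
open import Data.Maybe using (Maybe; just; nothing)
open import Data.Maybe.Properties using (just-injective; ≡-dec)
open import Data.Nat using (ℕ; _+_; _≤_; zero; suc; s≤s; _∸_; _*_; _<_; NonZero)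
open import Data.Nat.Coprimality using (Coprime; coprime-divisor)
open import Data.Nat.DivMod using (_%_; _/_; _mod_; m≡m%n+[m/n]*n; %-distribˡ-+; [m+n]%n≡m%n; m%n<n)
open import Data.Nat.Divisibility using (_∣_; divides; ∣m+n∣m⇒∣n; ∣1⇒≡1; ∣n⇒∣m*n; >⇒∤)
open import Data.Nat.Properties using (+-comm; +-identityʳ; *-distribˡ-∸; *-distribʳ-∸; [m+n]∸[m+o]≡n∸o; m+[n∸m]≡n; m≤m+n; m≤n+m; ≤-trans; ≤-antisym; ≤-pred; <⇒≤; ≤-<-trans; <-irrefl; m∸n≤m; m∸n≡0⇒m≤n; *-monoʳ-<; *-monoˡ-<; ∸-cancelˡ-≡; m+n≤o⇒m≤o∸n; +-suc; +-mono-≤; n<1+n; ≤-reflexive; ≤⇒≯; <⇒≱; m<n⇒m<1+n)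
open import Data.Nat.Tactic.RingSolver using (solve-∀)
open import Data.Product using (∃; _×_; _,_; proj₁; proj₂)
open import Data.Product.Function.NonDependent.Propositional using (_×-↔_)
open import Data.Sum using (_⊎_; inj₁; inj₂; swap)
open import Data.Sum.Properties using (inj₁-injective)
open import Data.Unit using (⊤; tt)
open import Data.Vec using ([]; _∷_; lookup; _[_]≔_)
open import Data.Vec.Properties using (lookup∘update; lookup∘update′; []≔-idempotent; []≔-commutes; []≔-lookup)
open import Function using (_∘_)
open import Function.Bundles using (_↔_; Injection)
open import Function.Construct.Composition using (_↔-∘_)
open import Function.Construct.Identity using (↔-id)
open import Function.Definitions using (Injective)
open import Function.Properties.Inverse using (↔⇒↣)
open import Relation.Binary.PropositionalEquality using (_≡_; _≢_; refl; sym; trans; cong; cong₂; subst; module ≡-Reasoning)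
open import Relation.Nullary using (¬_; yes; no; contradiction)


-- Finite search

-- Phrased with two arbitrary predicates, so that the outcome of one search is the hypothesis of the
-- next and, through `swap`, alternating quantifiers can be searched.
Searchable : Set → Set₁
Searchable X = ∀ {A B : X → Set} → (∀ x → A x ⊎ B x) → (∀ x → A x) ⊎ ∃ B

search-Bool : Searchable Bool
search-Bool f with f false | f true
... | inj₂ b | _      = inj₂ (false , b)
... | inj₁ _ | inj₂ b = inj₂ (true , b)
... | inj₁ a | inj₁ a′ = inj₁ λ { false → a ; true → a′ }

search-Fin : ∀ n → Searchable (Fin n)
search-Fin zero    f = inj₁ λ ()
search-Fin (suc n) f with f zero | search-Fin n (f ∘ suc)
... | inj₂ b | _            = inj₂ (zero , b)
... | inj₁ _ | inj₂ (i , b) = inj₂ (suc i , b)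
... | inj₁ a | inj₁ as      = inj₁ λ { zero → a ; (suc i) → as i }

search-× : ∀ {X Y : Set} → Searchable X → Searchable Y → Searchable (X × Y)
search-× sX sY f with sX (λ x → sY (λ y → f (x , y)))
... | inj₁ as            = inj₁ λ { (x , y) → as x y }
... | inj₂ (x , (y , b)) = inj₂ ((x , y) , b)

search-Vertex : ∀ d → Searchable (Vertex d)
search-Vertex zero    f with f []
... | inj₁ a = inj₁ λ { [] → a }
... | inj₂ b = inj₂ ([] , b)
search-Vertex (suc d) f with search-× search-Bool (search-Vertex d) (λ (b , v) → f (b ∷ v))
... | inj₁ as            = inj₁ λ { (b ∷ v) → as (b , v) }
... | inj₂ ((b , v) , p) = inj₂ (b ∷ v , p)

injective⇒surjective : ∀ {m n} {g : Fin m → Fin n} → Injective _≡_ _≡_ g → n ≤ m → ∀ y → ∃ λ x → g x ≡ y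
injective⇒surjective {m} {suc n} {g} inj n≤m y with any? (λ x → g x ≟ᶠ y)
... | yes hit = hit
... | no ¬hit = contradiction (≤-trans n≤m m≤n) (<-irrefl refl)
  where
  miss : ∀ x → y ≢ g x
  miss x eq = ¬hit (x , sym eq)
  m≤n : m ≤ n
  m≤n = injective⇒≤ {f = λ x → punchOut (miss x)} λ eq → inj (punchOut-injective (miss _) (miss _) eq)

Fin*2↔×Bool : ∀ m → Fin (m * 2) ↔ (Fin m × Bool)
Fin*2↔×Bool m = (↔-id _ ×-↔ 2↔Bool) ↔-∘ *↔×

-- Congruences

∣-small : ∀ {N k} → N ∣ k → k < N → k ≡ 0
∣-small {k = zero}  _   _   = refl
∣-small {k = suc k} N∣k k<N = contradiction N∣k (>⇒∤ k<N)

%-≡⇒∣∸ : ∀ N .{{_ : NonZero N}} a b → a % N ≡ b % N → N ∣ b ∸ a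
%-≡⇒∣∸ N a b eq = divides (b / N ∸ a / N) (begin
  b ∸ a
    ≡⟨ cong₂ _∸_ (m≡m%n+[m/n]*n b N) (m≡m%n+[m/n]*n a N) ⟩
  (b % N + b / N * N) ∸ (a % N + a / N * N)
    ≡⟨ cong (λ z → (b % N + b / N * N) ∸ (z + a / N * N)) eq ⟩
  (b % N + b / N * N) ∸ (b % N + a / N * N)
    ≡⟨ [m+n]∸[m+o]≡n∸o (b % N) _ _ ⟩
  b / N * N ∸ a / N * N
    ≡⟨ sym (*-distribʳ-∸ N (b / N) (a / N)) ⟩
  (b / N ∸ a / N) * N ∎)
  where open ≡-Reasoning

-- The difference is a multiple of `N` below `N`, hence zero. Truncated subtraction yields one
-- inequality at a time, so `go` is run in both orders.
%-cancelˡ : ∀ N .{{_ : NonZero N}} r {a b} → a < N → b < N → (r + a) % N ≡ (r + b) % N → a ≡ b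
%-cancelˡ N r {a} {b} a<N b<N eq = ≤-antisym (go b<N a<N (sym eq)) (go a<N b<N eq)
  where
  go : ∀ {a b} → a < N → b < N → (r + a) % N ≡ (r + b) % N → b ≤ a
  go {a} {b} a<N b<N eq = m∸n≡0⇒m≤n (∣-small
    (subst (N ∣_) ([m+n]∸[m+o]≡n∸o r b a) (%-≡⇒∣∸ N (r + a) (r + b) eq))
    (≤-<-trans (m∸n≤m b a) b<N))

%-cong-+ : ∀ N .{{_ : NonZero N}} {a a′ b b′} → a % N ≡ a′ % N → b % N ≡ b′ % N → (a + b) % N ≡ (a′ + b′) % N
%-cong-+ N {a} {a′} {b} {b′} p q =
  trans (%-distribˡ-+ a b N) (trans (cong₂ (λ x y → (x + y) % N) p q) (sym (%-distribˡ-+ a′ b′ N)))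

odd-coprime-2 : ∀ h → Coprime (suc (h + h)) 2
odd-coprime-2 h {i} (i∣N , i∣2) = ∣1⇒≡1 (∣m+n∣m⇒∣n (subst (i ∣_) (split h) i∣N) (∣n⇒∣m*n h i∣2))
  where
  split : ∀ h → suc (h + h) ≡ h * 2 + 1
  split = solve-∀

-- 2 is invertible modulo the odd number 2h + 1. This will recover a round `r` from the sum 2r of
-- one of its pairs.
halve-% : ∀ h {r s} → let N = suc (h + h) in r < N → s < N → (2 * r) % N ≡ (2 * s) % N → r ≡ s
halve-% h r<N s<N eq = ≤-antisym (go s<N r<N (sym eq)) (go r<N s<N eq)
  where
  N : ℕ
  N = suc (h + h)
  go : ∀ {r s} → r < N → s < N → (2 * r) % N ≡ (2 * s) % N → s ≤ r
  go {r} {s} r<N s<N eq = m∸n≡0⇒m≤n (∣-small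
    (coprime-divisor (odd-coprime-2 h) (subst (N ∣_) (sym (*-distribˡ-∸ 2 s r)) (%-≡⇒∣∸ N (2 * r) (2 * s) eq)))
    (≤-<-trans (m∸n≤m s r) s<N))

-- Abstract, so that the unifier can recover a from residue N a.
abstract
  residue : ∀ N .{{_ : NonZero N}} → ℕ → Fin N
  residue N a = a mod N

  residue-≡⇒%-≡ : ∀ {N} .{{_ : NonZero N}} {a b} → residue N a ≡ residue N b → a % N ≡ b % N
  residue-≡⇒%-≡ {N} {a} {b} eq =
    trans (sym (toℕ-fromℕ< (m%n<n a N))) (trans (cong toℕ eq) (toℕ-fromℕ< (m%n<n b N)))

rotate : ∀ {h} → Fin (suc h) → Fin (suc h) → Fin (suc h)
rotate {h} t p = residue (suc h) (toℕ t + toℕ p)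

rotate-injectiveʳ : ∀ {h} (t : Fin (suc h)) {p q} → rotate t p ≡ rotate t q → p ≡ q
rotate-injectiveʳ {h} t {p} {q} eq =
  toℕ-injective (%-cancelˡ (suc h) (toℕ t) (toℕ<n p) (toℕ<n q) (residue-≡⇒%-≡ eq))

rotate-injectiveˡ : ∀ {h} {t u : Fin (suc h)} p → rotate t p ≡ rotate u p → t ≡ u
rotate-injectiveˡ {h} {t} {u} p eq =
  toℕ-injective (%-cancelˡ (suc h) (toℕ p) (toℕ<n t) (toℕ<n u)
    (subst (λ z → z % suc h ≡ (toℕ p + toℕ u) % suc h) (+-comm (toℕ t) (toℕ p))
      (trans (residue-≡⇒%-≡ eq) (cong (_% suc h) (+-comm (toℕ u) (toℕ p))))))

-- Round-robin 1-factorisation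

-- Vertex zero is the point at infinity and suc x is the residue x modulo 2h+1.
-- The p-th pair of round r is {r + p, r - p}, except that the 0-th is {r, ∞}.
member : ∀ h → Fin (suc (h + h)) → Fin (suc h) → Bool → Fin (suc (suc (h + h)))
member h r p       false = suc (residue (suc (h + h)) (toℕ r + toℕ p))
member h r zero    true  = zero
member h r (suc p) true  = suc (residue (suc (h + h)) (toℕ r + (h + h ∸ toℕ p)))

module _ (h : ℕ) where
  private
    N : ℕ
    N = suc (h + h)

    slot<N : ∀ (p : Fin (suc h)) → toℕ p < N
    slot<N p = ≤-trans (toℕ<n p) (s≤s (m≤m+n h h))

    slot≤ : ∀ (p : Fin h) → toℕ p ≤ h + h
    slot≤ p = ≤-trans (<⇒≤ (toℕ<n p)) (m≤m+n h h)

    neg<N : ∀ (p : Fin h) → h + h ∸ toℕ p < N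
    neg<N p = s≤s (m∸n≤m (h + h) (toℕ p))

    -- `h + h ∸ toℕ q` represents -(q + 1) modulo 2h + 1. Such offsets are at least h + 1 and the
    -- positive ones at most h, so the two kinds never collide.
    slot<neg : ∀ (p : Fin (suc h)) (q : Fin h) → toℕ p < h + h ∸ toℕ q
    slot<neg p q = m+n≤o⇒m≤o∸n (suc (toℕ p))
      (subst (_≤ h + h) (+-suc (toℕ p) (toℕ q)) (+-mono-≤ (≤-pred (toℕ<n p)) (toℕ<n q)))

    -- The offsets p + 1 and 2h - p add up to the modulus, so the sum of a finite pair depends on
    -- the round alone.
    double : ∀ r (p : Fin h) → ((r + toℕ (suc p)) + (r + (h + h ∸ toℕ p))) % N ≡ (2 * r) % N
    double r p = trans (cong (_% N) eq) ([m+n]%n≡m%n (2 * r) N)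
      where
      reassoc : ∀ r p q → (r + suc p) + (r + q) ≡ 2 * r + suc (p + q)
      reassoc = solve-∀
      eq : (r + toℕ (suc p)) + (r + (h + h ∸ toℕ p)) ≡ 2 * r + N
      eq = trans (reassoc r (toℕ p) _)
        (cong (λ z → 2 * r + suc z) (m+[n∸m]≡n (slot≤ p)))

    member-%≡ : ∀ {a b} → _≡_ {A = Fin (suc N)} (suc (residue N a)) (suc (residue N b)) → a % N ≡ b % N
    member-%≡ = residue-≡⇒%-≡ ∘ suc-injective

  member-injective : ∀ r p b p′ b′ → member h r p b ≡ member h r p′ b′ → p ≡ p′ × b ≡ b′
  member-injective r p false p′ false eq =
    toℕ-injective (%-cancelˡ N (toℕ r) (slot<N p) (slot<N p′) (member-%≡ eq)) , refl
  member-injective r p false (suc q) true eq = contradiction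
    (%-cancelˡ N (toℕ r) (slot<N p) (neg<N q) (member-%≡ eq)) λ e → <-irrefl e (slot<neg p q)
  member-injective r zero true zero true eq = refl , refl
  member-injective r (suc q) true p′ false eq = contradiction
    (%-cancelˡ N (toℕ r) (neg<N q) (slot<N p′) (member-%≡ eq)) λ e → <-irrefl (sym e) (slot<neg p′ q)
  member-injective r (suc p) true (suc q) true eq =
    cong suc (toℕ-injective (∸-cancelˡ-≡ (slot≤ p) (slot≤ q) (%-cancelˡ N (toℕ r) (neg<N p) (neg<N q) (member-%≡ eq)))) , refl

  -- Slots and ends make 2(h + 1) choices, as many as there are vertices, so injectivity suffices:
  -- each round is a perfect matching.
  member-surjective : ∀ r x → ∃ λ p → ∃ λ b → member h r p b ≡ x
  member-surjective r x with injective⇒surjective {g = g} g-inj n≤ x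
    where
    open Injection (↔⇒↣ (Fin*2↔×Bool (suc h))) using (to; injective)
    g : Fin (suc h * 2) → Fin (suc N)
    g k = member h r (proj₁ (to k)) (proj₂ (to k))
    g-inj : Injective _≡_ _≡_ g
    g-inj {k} {l} eq with member-injective r _ _ _ _ eq
    ... | p , q = injective (cong₂ _,_ p q)
    n≤ : suc N ≤ suc h * 2
    n≤ = ≤-reflexive (double-suc h)
      where
      double-suc : ∀ h → suc (suc (h + h)) ≡ suc h * 2
      double-suc = solve-∀
  ... | k , eq = _ , _ , eq

  private
    -- A pair containing infinity shows `r` as its other vertex; a finite pair shows 2r as its sum,
    -- and the 2 cancels. In the mixed cases infinity would have to lie in a finite pair.
    round-unique : ∀ r r′ p p′ b b′ → member h r p b ≡ member h r′ p′ b′ →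
      member h r p (not b) ≡ member h r′ p′ (not b′) → r ≡ r′
    round-unique r r′ zero zero b b′ eq eq′ = toℕ-injective (%-cancelˡ N 0 (toℕ<n r) (toℕ<n r′) (finite b b′ eq eq′))
      where
      strip : _≡_ {A = Fin (suc N)} (suc (residue N (toℕ r + 0))) (suc (residue N (toℕ r′ + 0))) → toℕ r % N ≡ toℕ r′ % N
      strip eq = trans (cong (_% N) (sym (+-identityʳ (toℕ r)))) (trans (member-%≡ eq) (cong (_% N) (+-identityʳ (toℕ r′))))
      finite : ∀ b b′ → member h r zero b ≡ member h r′ zero b′ →
        member h r zero (not b) ≡ member h r′ zero (not b′) → toℕ r % N ≡ toℕ r′ % N
      finite false false eq _   = strip eq
      finite true  true  _  eq′ = strip eq′
      finite false true  () _
      finite true  false () _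
    round-unique r r′ zero (suc p′) false false _ ()
    round-unique r r′ zero (suc p′) false true  _ ()
    round-unique r r′ zero (suc p′) true  false () _
    round-unique r r′ zero (suc p′) true  true  () _
    round-unique r r′ (suc p) zero false false _ ()
    round-unique r r′ (suc p) zero true  false _ ()
    round-unique r r′ (suc p) zero false true  () _
    round-unique r r′ (suc p) zero true  true  () _
    round-unique r r′ (suc p) (suc p′) b b′ eq eq′ =
      toℕ-injective (halve-% h (toℕ<n r) (toℕ<n r′)
        (trans (sym (double (toℕ r) p)) (trans (sums b b′ eq eq′) (double (toℕ r′) p′))))
      where
      plus minus : Fin N → Fin h → ℕ
      plus  r p = toℕ r + toℕ (suc p)
      minus r p = toℕ r + (h + h ∸ toℕ p)
      -- The two pairs may list their members in opposite orders; the sum does not see this.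
      sums : ∀ b b′ → member h r (suc p) b ≡ member h r′ (suc p′) b′ →
        member h r (suc p) (not b) ≡ member h r′ (suc p′) (not b′) →
        (plus r p + minus r p) % N ≡ (plus r′ p′ + minus r′ p′) % N
      flip : (minus r′ p′ + plus r′ p′) % N ≡ (plus r′ p′ + minus r′ p′) % N
      flip = cong (_% N) (+-comm (minus r′ p′) (plus r′ p′))
      sums false false e e′ = %-cong-+ N {plus r p} {plus r′ p′} {minus r p} {minus r′ p′} (member-%≡ e) (member-%≡ e′)
      sums true  true  e e′ = %-cong-+ N {plus r p} {plus r′ p′} {minus r p} {minus r′ p′} (member-%≡ e′) (member-%≡ e)
      sums false true  e e′ = trans (%-cong-+ N {plus r p} {minus r′ p′} {minus r p} {plus r′ p′} (member-%≡ e) (member-%≡ e′)) flip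
      sums true  false e e′ = trans (%-cong-+ N {plus r p} {minus r′ p′} {minus r p} {plus r′ p′} (member-%≡ e′) (member-%≡ e)) flip

  pair-unique : ∀ r r′ p p′ b b′ → member h r p b ≡ member h r′ p′ b′ →
    member h r p (not b) ≡ member h r′ p′ (not b′) → r ≡ r′ × p ≡ p′ × b ≡ b′
  pair-unique r r′ p p′ b b′ eq eq′ with round-unique r r′ p p′ b b′ eq eq′
  ... | refl = refl , member-injective r p b p′ b′ eq

-- Edges of the cube

edge-≡ : ∀ {d} {e e′ : Edge d} → proj₁ e ≡ proj₁ e′ → e ≡ e′
edge-≡ {e = (v , i) , p} {_ , q} refl = cong ((v , i) ,_) (Decidable⇒UIP.≡-irrelevant _≟ᵇ_ p q)

edgeAt-cong : ∀ {d} {u v : Vertex d} i → u [ i ]≔ false ≡ v [ i ]≔ false → edgeAt u i ≡ edgeAt v i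
edgeAt-cong i eq = edge-≡ (cong (_, i) eq)

edgeAt-lower : ∀ {d} (e : Edge d) → edgeAt (proj₁ (proj₁ e)) (proj₂ (proj₁ e)) ≡ e
edgeAt-lower ((v , i) , p) = edge-≡ (cong (_, i) (trans (cong (v [ i ]≔_) (sym p)) ([]≔-lookup v i)))

direction : ∀ {d} → Edge d → Fin d
direction ((_ , i) , _) = i

-- For `j` other than the direction of the edge, this is the opposite edge in the 4-cycle that the
-- edge spans with `j`.
translate : ∀ {d} → Edge d → Fin d → Edge d
translate ((v , i) , _) j = edgeAt (v [ j ]≔ not (lookup v j)) i

translate-edgeAt : ∀ {d} (u : Vertex d) {i j} → i ≢ j → ∀ k →
  translate (edgeAt (u [ j ]≔ k) i) j ≡ edgeAt (u [ j ]≔ not k) i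
translate-edgeAt u {i} {j} i≢j k = edgeAt-cong i (begin
  ((w [ i ]≔ false) [ j ]≔ not (lookup (w [ i ]≔ false) j)) [ i ]≔ false
    ≡⟨ cong (λ x → ((w [ i ]≔ false) [ j ]≔ not x) [ i ]≔ false)
         (trans (lookup∘update′ (i≢j ∘ sym) w false) (lookup∘update j u k)) ⟩
  ((w [ i ]≔ false) [ j ]≔ not k) [ i ]≔ false
    ≡⟨ cong (_[ i ]≔ false) ([]≔-commutes w i j i≢j) ⟩
  ((w [ j ]≔ not k) [ i ]≔ false) [ i ]≔ false
    ≡⟨ []≔-idempotent (w [ j ]≔ not k) i ⟩
  (w [ j ]≔ not k) [ i ]≔ false
    ≡⟨ cong (_[ i ]≔ false) ([]≔-idempotent u j) ⟩
  (u [ j ]≔ not k) [ i ]≔ false ∎)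
  where
  open ≡-Reasoning
  w = u [ j ]≔ k

-- Two sides of a 4-cycle in different directions always meet; `w` is their common corner.
adjacent-≢ : ∀ {d} {φ : PartialColoring d} → IsProperPartial φ → ∀ u {i j} → i ≢ j → ∀ k l {c} →
  φ (edgeAt (u [ j ]≔ k) i) ≡ just c → φ (edgeAt (u [ i ]≔ l) j) ≢ just c
adjacent-≢ {φ = φ} proper u {i} {j} i≢j k l eq eq′ = proper w i j _ _ i≢j
  (trans (cong φ (edgeAt-cong i ([]≔-idempotent (u [ j ]≔ k) i))) eq)
  (trans (cong φ (edgeAt-cong j (trans (cong (_[ j ]≔ false) ([]≔-commutes u j i (i≢j ∘ sym)))
    ([]≔-idempotent (u [ i ]≔ l) j)))) eq′)
  refl
  where w = (u [ j ]≔ k) [ i ]≔ l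

allVertices-complete : ∀ {d} (v : Vertex d) → v ∈ allVertices d
allVertices-complete []      = here refl
allVertices-complete (b ∷ v) = ∈-concatMap⁺ _ (lose (allVertices-complete v) (extend b))
  where
  extend : ∀ b → b ∷ v ∈ (false ∷ v) List.∷ (true ∷ v) List.∷ List.[]
  extend false = here refl
  extend true  = there (here refl)

∈-mapMaybe⁺ : ∀ {A B : Set} (f : A → Maybe B) {x y xs} → x ∈ xs → f x ≡ just y → y ∈ mapMaybe f xs
∈-mapMaybe⁺ f {x} (here refl) eq with f x
∈-mapMaybe⁺ f {x} (here refl) refl | just _ = here refl
∈-mapMaybe⁺ f {xs = z List.∷ _} (there x∈) eq with f z
... | just _  = there (∈-mapMaybe⁺ f x∈ eq)
... | nothing = ∈-mapMaybe⁺ f x∈ eq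

-- Exposes the selection function local to the definition of allEdges.
selection : ∀ d → ∃ λ (mk : Vertex d → Fin d → Maybe (Edge d)) →
  allEdges d ≡ concatMap (λ v → mapMaybe (mk v) (allFin d)) (allVertices d)
selection d = _ , refl

allEdges-complete : ∀ {d} (e : Edge d) → e ∈ allEdges d
allEdges-complete {d} e@((v , i) , p) =
  ∈-concatMap⁺ _ (lose (allVertices-complete v) (∈-mapMaybe⁺ _ (∈-allFin i) selected))
  where
  selected : proj₁ (selection d) v i ≡ just e
  selected with lookup v i ≟ᵇ false
  ... | yes q = cong just (edge-≡ refl)
  ... | no ¬p = contradiction p ¬p

colored? : ∀ {d} (φ : PartialColoring d) e → φ e ≡ nothing ⊎ ∃ λ a → φ e ≡ just a
colored? φ e with φ e
... | nothing = inj₁ refl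
... | just a  = inj₂ (a , refl)

has-color? : ∀ {d} (φ : PartialColoring d) e c → φ e ≢ just c ⊎ φ e ≡ just c
has-color? φ e c with ≡-dec _≟ᶠ_ (φ e) (just c)
... | yes eq = inj₂ eq
... | no ¬eq = inj₁ ¬eq

colorClass : ∀ {d} → PartialColoring d → Fin d → List (Edge d)
colorClass {d} φ c = filter (λ e → ≡-dec _≟ᶠ_ (φ e) (just c)) (allEdges d)

∈-colorClass : ∀ {d} (φ : PartialColoring d) {c e} → φ e ≡ just c → e ∈ colorClass φ c
∈-colorClass φ {c} eq = ∈-filter⁺ (λ e → ≡-dec _≟ᶠ_ (φ e) (just c)) (allEdges-complete _) eq

rank : ∀ {d} (φ : PartialColoring d) {c e} → φ e ≡ just c → Fin (colorCount φ c)
rank φ eq = index (∈-colorClass φ eq)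

-- Looking up the position returns the edge. A bound on `colorCount` thereby becomes a bound on the
-- number of codes needed for the edges of one colour.
rank-injective : ∀ {d} (φ : PartialColoring d) {c e e′} (p : φ e ≡ just c) (q : φ e′ ≡ just c) →
  rank φ p ≡ rank φ q → e ≡ e′
rank-injective φ {c} p q eq = trans (lookup-index (∈-colorClass φ p))
  (trans (cong (List.lookup (colorClass φ c)) eq) (sym (lookup-index (∈-colorClass φ q))))

-- Colourings by paired directions

-- `δ` and `γ` split directions and colours into 2h + 2 to be paired up and a leftover part `L`:
-- empty for even `d`, a single point for odd `d`. The leftover direction `l` is coloured throughout
-- by the leftover colour `l`, which `free` permits.
module Pairing {d : ℕ} (φ : PartialColoring d) (φ-proper : IsProperPartial φ) (h : ℕ) {L : Set}
  (δ : Fin (suc (suc (h + h))) ⊎ L → Fin d) (δ⁻¹ : Fin d → Fin (suc (suc (h + h))) ⊎ L)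
  (δ-injective : Injective _≡_ _≡_ δ) (δ∘δ⁻¹ : ∀ i → δ (δ⁻¹ i) ≡ i)
  (γ : Fin (suc (suc (h + h))) ⊎ L → Fin d) (γ-injective : Injective _≡_ _≡_ γ)
  (free : ∀ l v → φ (edgeAt v (δ (inj₂ l))) ≢ just (γ (inj₂ l))) where

  private
    N n : ℕ
    N = suc (h + h)
    n = suc N

  -- A round for the directions, a round for the colours, and a rotation matching
  -- the pairs of the former with the pairs of the latter.
  Config : Set
  Config = Fin N × Fin N × Fin (suc h)

  search-Config : Searchable Config
  search-Config = search-× (search-Fin N) (search-× (search-Fin N) (search-Fin (suc h)))

  dir : Config → Fin (suc h) → Bool → Fin d
  dir (r , _ , _) p b = δ (inj₁ (member h r p b))

  col : Config → Fin (suc h) → Bool → Fin d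
  col (_ , s , t) p b = γ (inj₁ (member h s (rotate t p) b))

  dir-≢ : ∀ κ p → dir κ p false ≢ dir κ p true
  dir-≢ κ p eq with proj₂ (member-injective h _ p false p true (inj₁-injective (δ-injective eq)))
  ... | ()

  dir-≢-not : ∀ κ p b → dir κ p b ≢ dir κ p (not b)
  dir-≢-not κ p false = dir-≢ κ p
  dir-≢-not κ p true  = dir-≢ κ p ∘ sym

  -- The four sides of the 4-cycle through `u` in the directions of pair `p`: `b` selects the
  -- direction, and `k` one of the two parallel sides by its value in the partner coordinate.
  side : Config → Vertex d → Fin (suc h) → Bool → Bool → Edge d
  side κ u p b k = edgeAt (u [ dir κ p (not b) ]≔ k) (dir κ p b)

  -- The Boolean `o` is one of the two alternating colourings of the 4-cycle: sides in direction `b`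
  -- receive colour `b xor o` of the pair.
  Works Clash : Config → Vertex d × Fin (suc h) → Set
  Works κ (u , p) = ∃ λ o → ∀ ((b , k) : Bool × Bool) → φ (side κ u p b k) ≢ just (col κ p (b xor o))
  Clash κ (u , p) = ∀ o → ∃ λ ((b , k) : Bool × Bool) → φ (side κ u p b k) ≡ just (col κ p (b xor o))

  works-or-clash : ∀ κ up → Works κ up ⊎ Clash κ up
  works-or-clash κ (u , p) = swap (search-Bool λ o → swap (search-× search-Bool search-Bool
    λ (b , k) → has-color? φ (side κ u p b k) (col κ p (b xor o))))

  -- The colouring from a configuration without bad 4-cycles

  module FromConfig (κ : Config) (works : ∀ up → Works κ up) where
    private
      r = proj₁ κ
      s = proj₁ (proj₂ κ)
      t = proj₂ (proj₂ κ)

    slot : Fin n → Fin (suc h)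
    slot x = proj₁ (member-surjective h r x)

    end : Fin n → Bool
    end x = proj₁ (proj₂ (member-surjective h r x))

    member-slot-end : ∀ x → member h r (slot x) (end x) ≡ x
    member-slot-end x = proj₂ (proj₂ (member-surjective h r x))

    -- A canonical corner of the 4-cycle, so that all four corners look up the same orientation.
    base : Fin (suc h) → Vertex d → Vertex d
    base p v = (v [ dir κ p false ]≔ false) [ dir κ p true ]≔ false

    base-update : ∀ p b v → base p (v [ dir κ p b ]≔ false) ≡ base p v
    base-update p false v = cong (_[ dir κ p true ]≔ false) ([]≔-idempotent v (dir κ p false))
    base-update p true v = begin
      ((v [ j ]≔ false) [ i ]≔ false) [ j ]≔ false ≡⟨ cong (_[ j ]≔ false) ([]≔-commutes v j i (dir-≢ κ p ∘ sym)) ⟩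
      ((v [ i ]≔ false) [ j ]≔ false) [ j ]≔ false ≡⟨ []≔-idempotent (v [ i ]≔ false) j ⟩
      (v [ i ]≔ false) [ j ]≔ false                ∎
      where
      open ≡-Reasoning
      i = dir κ p false
      j = dir κ p true

    side-base : ∀ p b v → side κ (base p v) p b (lookup v (dir κ p (not b))) ≡ edgeAt v (dir κ p b)
    side-base p false v = edgeAt-cong i (begin
      (((v [ i ]≔ false) [ j ]≔ false) [ j ]≔ lookup v j) [ i ]≔ false
        ≡⟨ cong (_[ i ]≔ false) ([]≔-idempotent (v [ i ]≔ false) j) ⟩
      ((v [ i ]≔ false) [ j ]≔ lookup v j) [ i ]≔ false
        ≡⟨ cong (_[ i ]≔ false) ([]≔-commutes v i j (dir-≢ κ p)) ⟩
      ((v [ j ]≔ lookup v j) [ i ]≔ false) [ i ]≔ false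
        ≡⟨ []≔-idempotent (v [ j ]≔ lookup v j) i ⟩
      (v [ j ]≔ lookup v j) [ i ]≔ false
        ≡⟨ cong (_[ i ]≔ false) ([]≔-lookup v j) ⟩
      v [ i ]≔ false ∎)
      where
      open ≡-Reasoning
      i = dir κ p false
      j = dir κ p true
    side-base p true v = edgeAt-cong j (begin
      (((v [ i ]≔ false) [ j ]≔ false) [ i ]≔ lookup v i) [ j ]≔ false
        ≡⟨ []≔-commutes ((v [ i ]≔ false) [ j ]≔ false) i j (dir-≢ κ p) ⟩
      (((v [ i ]≔ false) [ j ]≔ false) [ j ]≔ false) [ i ]≔ lookup v i
        ≡⟨ cong (_[ i ]≔ lookup v i) ([]≔-idempotent (v [ i ]≔ false) j) ⟩
      ((v [ i ]≔ false) [ j ]≔ false) [ i ]≔ lookup v i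
        ≡⟨ sym ([]≔-commutes (v [ i ]≔ false) i j (dir-≢ κ p)) ⟩
      ((v [ i ]≔ false) [ i ]≔ lookup v i) [ j ]≔ false
        ≡⟨ cong (_[ j ]≔ false) (trans ([]≔-idempotent v i) ([]≔-lookup v i)) ⟩
      v [ j ]≔ false ∎)
      where
      open ≡-Reasoning
      i = dir κ p false
      j = dir κ p true

    orient : Fin (suc h) → Vertex d → Bool
    orient p v = proj₁ (works (base p v , p))

    place : Fin n ⊎ L → Vertex d → Fin n ⊎ L
    place (inj₁ x) v = inj₁ (member h s (rotate t (slot x)) (end x xor orient (slot x) v))
    place (inj₂ l) v = inj₂ l

    -- Both ends of an edge lie on the same 4-cycle, so the colour may be read at either end.
    place-update : ∀ z v → place z (v [ δ z ]≔ false) ≡ place z v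
    place-update (inj₂ l) v = refl
    place-update (inj₁ x) v = cong
      (λ u → inj₁ (member h s (rotate t (slot x)) (end x xor proj₁ (works (u , slot x)))))
      (trans (cong (λ y → base (slot x) (v [ δ (inj₁ y) ]≔ false)) (sym (member-slot-end x)))
        (base-update (slot x) (end x) v))

    xor-cancelʳ : ∀ {a b} o → a xor o ≡ b xor o → a ≡ b
    xor-cancelʳ {false} {false} o     _ = refl
    xor-cancelʳ {true}  {true}  o     _ = refl
    xor-cancelʳ {false} {true}  false ()
    xor-cancelʳ {false} {true}  true  ()
    xor-cancelʳ {true}  {false} false ()
    xor-cancelʳ {true}  {false} true  ()

    -- Equal places share the colour pair, and undoing the rotation gives equal direction pairs;
    -- both directions then see the same orientation, which cancels from the `xor`.
    place-injective : ∀ z z′ v → place z v ≡ place z′ v → z ≡ z′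
    place-injective (inj₂ l) (inj₂ l′) v eq = eq
    place-injective (inj₁ x) (inj₁ y) v eq
      with member-injective h s _ _ _ _ (inj₁-injective eq)
    ... | p , q = cong inj₁ (trans (sym (member-slot-end x))
      (trans (cong₂ (member h r) slot≡ end≡) (member-slot-end y)))
      where
      slot≡ : slot x ≡ slot y
      slot≡ = rotate-injectiveʳ t p
      end≡ : end x ≡ end y
      end≡ = xor-cancelʳ (orient (slot x) v)
        (trans q (cong (λ z → end y xor orient z v) (sym slot≡)))

    coloring : Coloring d
    coloring ((v , i) , _) = γ (place (δ⁻¹ i) v)

    coloring-edgeAt : ∀ v i → coloring (edgeAt v i) ≡ γ (place (δ⁻¹ i) v)
    coloring-edgeAt v i = cong γ
      (trans (cong (λ j → place (δ⁻¹ i) (v [ j ]≔ false)) (sym (δ∘δ⁻¹ i))) (place-update (δ⁻¹ i) v))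

    coloring-proper : IsProper coloring
    coloring-proper v i j i≢j eq = i≢j (trans (sym (δ∘δ⁻¹ i)) (trans (cong δ z≡z′) (δ∘δ⁻¹ j)))
      where
      z≡z′ : δ⁻¹ i ≡ δ⁻¹ j
      z≡z′ = place-injective _ _ v (γ-injective
        (trans (sym (coloring-edgeAt v i)) (trans eq (coloring-edgeAt v j))))

    place-avoids : ∀ z v → φ (edgeAt v (δ z)) ≢ just (γ (place z v))
    place-avoids (inj₂ l) v eq = free l v eq
    place-avoids (inj₁ x) v eq = proj₂ (works (base (slot x) v , slot x)) (end x , _)
      (trans (cong φ (trans (side-base (slot x) (end x) v)
        (cong (edgeAt v ∘ δ ∘ inj₁) (member-slot-end x)))) eq)

    avoids : ∀ e c → φ e ≡ just c → coloring e ≢ c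
    avoids e@((v , i) , _) c φe≡c fe≡c = place-avoids (δ⁻¹ i) v (trans
      (cong φ (trans (cong (edgeAt v) (δ∘δ⁻¹ i)) (edgeAt-lower e)))
      (trans φe≡c (cong just (sym fe≡c))))

  -- Flags of bad 4-cycles

  record Flag : Set where
    constructor flag
    field
      e : Edge d
      i j x y : Fin n
      i≢j : i ≢ j
      x≢y : x ≢ y
      e-dir : direction e ≡ δ (inj₁ i)
      e-col : φ e ≡ just (γ (inj₁ x))
      opp-col : φ (translate e (δ (inj₁ j))) ≡ just (γ (inj₁ y))

  -- `β` tells which colour of its pair the edge `e` carries. The two conflicting edges of a bad
  -- 4-cycle give flags with different `β`, whence the factor 2 in the count.
  record FlagOf (κ : Config) (β : Bool) : Set where
    field
      F : Flag
      p : Fin (suc h)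
      b : Bool
    open Flag F public
    field
      i≡ : i ≡ member h (proj₁ κ) p b
      j≡ : j ≡ member h (proj₁ κ) p (not b)
      x≡ : x ≡ member h (proj₁ (proj₂ κ)) (rotate (proj₂ (proj₂ κ)) p) β
      y≡ : y ≡ member h (proj₁ (proj₂ κ)) (rotate (proj₂ (proj₂ κ)) p) (not β)

  member-≢-not : ∀ r p b → member h r p b ≢ member h r p (not b)
  member-≢-not r p b eq with b | proj₂ (member-injective h r p b p (not b) eq)
  ... | false | ()
  ... | true  | ()

  -- `e` and `j` determine the ordered pair of directions and the ordered pair of colours. The
  -- former yields `r` and the slot, the latter `s`, the rotated slot and `β`; comparing the slots
  -- yields `t`.
  flagOf-unique : ∀ {κ κ′ β β′} (A : FlagOf κ β) (B : FlagOf κ′ β′) →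
    FlagOf.e A ≡ FlagOf.e B → FlagOf.j A ≡ FlagOf.j B → (κ , β) ≡ (κ′ , β′)
  flagOf-unique {r , s , t} {r′ , s′ , t′} {β} {β′} A B e≡ j≡ = result
    where
    module A = FlagOf A
    module B = FlagOf B
    i≡ : A.i ≡ B.i
    i≡ = inj₁-injective (δ-injective (trans (sym A.e-dir) (trans (cong direction e≡) B.e-dir)))
    color≡ : ∀ {x y} {e e′ : Edge d} → e ≡ e′ → φ e ≡ just (γ (inj₁ x)) → φ e′ ≡ just (γ (inj₁ y)) → x ≡ y
    color≡ refl p q = inj₁-injective (γ-injective (just-injective (trans (sym p) q)))
    result : ((r , s , t) , β) ≡ ((r′ , s′ , t′) , β′)
    result with pair-unique h r r′ A.p B.p A.b B.b
                  (trans (sym A.i≡) (trans i≡ B.i≡)) (trans (sym A.j≡) (trans j≡ B.j≡))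
              | pair-unique h s s′ (rotate t A.p) (rotate t′ B.p) β β′
                  (trans (sym A.x≡) (trans (color≡ e≡ A.e-col B.e-col) B.x≡))
                  (trans (sym A.y≡) (trans (color≡ (cong₂ (λ e j → translate e (δ (inj₁ j))) e≡ j≡) A.opp-col B.opp-col) B.y≡))
    ... | refl , p≡ , _ | refl , q≡ , refl = cong (λ t → (r , s , t) , β)
      (rotate-injectiveˡ A.p (trans q≡ (cong (rotate t′) (sym p≡))))

  module _ (κ : Config) (u : Vertex d) (p : Fin (suc h)) where
    private
      r = proj₁ κ
      s = proj₁ (proj₂ κ)
      t = proj₂ (proj₂ κ)

    parallel⇒flagOf : ∀ b k β → φ (side κ u p b k) ≡ just (col κ p β) →
      φ (side κ u p b (not k)) ≡ just (col κ p (not β)) → FlagOf κ β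
    parallel⇒flagOf b k β eq eq′ = record
      { F = flag (side κ u p b k) _ _ _ _ (member-≢-not r p b) (member-≢-not s (rotate t p) β) refl eq
              (trans (cong φ (translate-edgeAt u (dir-≢-not κ p b) k)) eq′)
      ; i≡ = refl ; j≡ = refl ; x≡ = refl ; y≡ = refl }

    -- If `k` and `l` agree, one edge has two colours. Otherwise the two sides are opposite, and
    -- starting from one or the other gives a flag for either `β′`.
    parallel⇒flagsOf : ∀ b k l β → φ (side κ u p b k) ≡ just (col κ p β) →
      φ (side κ u p b l) ≡ just (col κ p (not β)) → ∀ β′ → FlagOf κ β′
    parallel⇒flagsOf b false false β eq eq′ _ = contradiction
      (inj₁-injective (γ-injective (just-injective (trans (sym eq) eq′)))) (member-≢-not s (rotate t p) β)
    parallel⇒flagsOf b true true β eq eq′ _ = contradiction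
      (inj₁-injective (γ-injective (just-injective (trans (sym eq) eq′)))) (member-≢-not s (rotate t p) β)
    parallel⇒flagsOf b false true false eq eq′ false = parallel⇒flagOf b false false eq eq′
    parallel⇒flagsOf b false true false eq eq′ true  = parallel⇒flagOf b true true eq′ eq
    parallel⇒flagsOf b false true true  eq eq′ true  = parallel⇒flagOf b false true eq eq′
    parallel⇒flagsOf b false true true  eq eq′ false = parallel⇒flagOf b true false eq′ eq
    parallel⇒flagsOf b true false false eq eq′ false = parallel⇒flagOf b true false eq eq′
    parallel⇒flagsOf b true false false eq eq′ true  = parallel⇒flagOf b false true eq′ eq
    parallel⇒flagsOf b true false true  eq eq′ true  = parallel⇒flagOf b true true eq eq′
    parallel⇒flagsOf b true false true  eq eq′ false = parallel⇒flagOf b false false eq′ eq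

    -- By properness, a 4-cycle for which both orientations fail has its two
    -- conflicting edges parallel; these carry the two colours of the pair.
    clash⇒flagsOf : Clash κ (u , p) → ∀ β → FlagOf κ β
    clash⇒flagsOf clash with clash false | clash true
    ... | (false , k) , eq | (true , k′) , eq′ =
      contradiction eq′ (adjacent-≢ {φ = φ} φ-proper u (dir-≢ κ p) k k′ eq)
    ... | (true , k) , eq | (false , k′) , eq′ =
      contradiction eq (adjacent-≢ {φ = φ} φ-proper u (dir-≢ κ p) k′ k eq′)
    ... | (false , k) , eq | (false , k′) , eq′ = parallel⇒flagsOf false k k′ false eq eq′
    ... | (true  , k) , eq | (true  , k′) , eq′ = parallel⇒flagsOf true k k′ true eq eq′

  -- Counting flags

  config×Bool↔ : Fin (N * (N * (suc h * 2))) ↔ (Fin N × Fin N × Fin (suc h) × Bool)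
  config×Bool↔ = (↔-id _ ×-↔ ((↔-id _ ×-↔ Fin*2↔×Bool (suc h)) ↔-∘ *↔×)) ↔-∘ *↔×

  -- Pigeonhole: if every configuration had a bad 4-cycle, its two flags would send the pairs of `κ`
  -- and `β` injectively into the codes. Only `e` and `j` must be recoverable from a code, since
  -- they identify that pair.
  few-flags⇒avoidable : ∀ {M} → M < N * (N * (suc h * 2)) → (code : Flag → Fin M) →
    (∀ F G → code F ≡ code G → Flag.e F ≡ Flag.e G × Flag.j F ≡ Flag.j G) → Avoidable φ
  few-flags⇒avoidable {M} M< code code-injective
    with search-Config (λ κ → swap (search-× (search-Vertex d) (search-Fin (suc h)) (works-or-clash κ)))
  ... | inj₂ (κ , works) = coloring , coloring-proper , avoids
    where open FromConfig κ works
  ... | inj₁ clashes = contradiction M< (≤⇒≯ (injective⇒≤ {f = g} g-injective))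
    where
    open Injection (↔⇒↣ config×Bool↔) using (to; injective)
    flagAt : ∀ κ β → FlagOf κ β
    flagAt κ = clash⇒flagsOf κ _ _ (proj₂ (clashes κ))
    g : Fin (N * (N * (suc h * 2))) → Fin M
    g k = let (r , s , t , β) = to k in code (FlagOf.F (flagAt (r , s , t) β))
    g-injective : Injective _≡_ _≡_ g
    g-injective eq with code-injective _ _ eq
    ... | e≡ , j≡ = injective (cong (λ ((r , s , t) , β) → r , s , t , β)
      (flagOf-unique (flagAt _ _) (flagAt _ _) e≡ j≡))

  module _ {K : ℕ} (bounded : ∀ c → colorCount φ c ≤ K) where

    bounded-rank : ∀ {e c} → φ e ≡ just c → Fin K
    bounded-rank {c = c} eq = inject≤ (rank φ eq) (bounded c)

    -- `k` names a translation direction among the `N` paired ones other than that of `e`. It is a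
    -- free argument so that candidates which are not flags have codes too.
    codeOf : ∀ {e x} → φ e ≡ just (γ (inj₁ x)) → Fin N → Fin (n * (K * N))
    codeOf {x = x} eq k = combine x (combine (bounded-rank eq) k)

    codeOf-injective : ∀ {e e′ x x′ k k′} (p : φ e ≡ just (γ (inj₁ x))) (q : φ e′ ≡ just (γ (inj₁ x′))) →
      codeOf p k ≡ codeOf q k′ → e ≡ e′ × k ≡ k′
    codeOf-injective {x = x} {x′} {k} {k′} p q eq with combine-injective x _ x′ _ eq
    ... | refl , eq′ with combine-injective (bounded-rank p) k (bounded-rank q) k′ eq′
    ... | r≡ , k≡ = rank-injective φ p q (inject≤-injective (bounded _) (bounded _) _ _ r≡) , k≡

    code : Flag → Fin (n * (K * N))
    code F = codeOf (Flag.e-col F) (punchOut (Flag.i≢j F))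

    code-injective : ∀ F G → code F ≡ code G → Flag.e F ≡ Flag.e G × Flag.j F ≡ Flag.j G
    code-injective F G eq with codeOf-injective (Flag.e-col F) (Flag.e-col G) eq
    ... | e≡ , k≡ = e≡ , j≡ i≡ (Flag.i≢j F) (Flag.i≢j G) k≡
      where
      i≡ : Flag.i F ≡ Flag.i G
      i≡ = inj₁-injective (δ-injective (trans (sym (Flag.e-dir F)) (trans (cong direction e≡) (Flag.e-dir G))))
      -- Generalised over both directions so that `i≡` can be matched with `refl`.
      j≡ : ∀ {i i′ j j′ : Fin n} → i ≡ i′ → (p : i ≢ j) (q : i′ ≢ j′) → punchOut p ≡ punchOut q → j ≡ j′
      j≡ refl = punchOut-injective

  private
    total : ∀ h → suc (suc (h + h)) * (suc (h + h) * suc (h + h)) ≡ suc (h + h) * (suc (h + h) * (suc h * 2))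
    total = solve-∀

  -- With K = 2h there are n(2h)N codes, strictly fewer than the nN² pairs of a configuration and a
  -- Boolean.
  sparse⇒avoidable : (∀ c → colorCount φ c ≤ h + h) → Avoidable φ
  sparse⇒avoidable bounded = few-flags⇒avoidable
    (subst (n * ((h + h) * N) <_) (total h) (*-monoʳ-< n (*-monoˡ-< N (n<1+n (h + h)))))
    (code bounded) (code-injective bounded)

  missed⇒avoidable : (bounded : ∀ c → colorCount φ c ≤ N) → ∀ τ → (∀ F → τ ≢ code bounded F) → Avoidable φ
  missed⇒avoidable bounded τ missed = few-flags⇒avoidable (≤-reflexive (total h))
    (λ F → punchOut (missed F))
    (λ F G eq → code-injective bounded F G (punchOut-injective (missed F) (missed G) eq))

-- Even dimension

even-case : ∀ h (φ : PartialColoring (suc (suc (h + h)))) → IsProperPartial φ →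
  (∀ c → colorCount φ c ≤ h + h) → Avoidable φ
even-case h φ proper bounded = Pairing.sparse⇒avoidable φ proper h {⊥} all inj₁
  all-injective (λ _ → refl) all all-injective (λ ()) bounded
  where
  all : Fin (suc (suc (h + h))) ⊎ ⊥ → Fin (suc (suc (h + h)))
  all (inj₁ x) = x
  all-injective : Injective _≡_ _≡_ all
  all-injective {inj₁ _} {inj₁ _} = cong inj₁

-- Odd dimension

insert : ∀ {n} → Fin (suc n) → Fin n ⊎ ⊤ → Fin (suc n)
insert a (inj₁ x) = punchIn a x
insert a (inj₂ _) = a

insert-injective : ∀ {n} (a : Fin (suc n)) → Injective _≡_ _≡_ (insert a)
insert-injective a {inj₁ x} {inj₁ y} eq = cong inj₁ (punchIn-injective a x y eq)
insert-injective a {inj₁ x} {inj₂ _} eq = contradiction eq (punchInᵢ≢i a x)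
insert-injective a {inj₂ _} {inj₁ y} eq = contradiction (sym eq) (punchInᵢ≢i a y)
insert-injective a {inj₂ _} {inj₂ _} eq = refl

remove : ∀ {n} → Fin (suc n) → Fin (suc n) → Fin n ⊎ ⊤
remove a i with a ≟ᶠ i
... | yes _  = inj₂ tt
... | no a≢i = inj₁ (punchOut a≢i)

insert-remove : ∀ {n} (a i : Fin (suc n)) → insert a (remove a i) ≡ i
insert-remove a i with a ≟ᶠ i
... | yes a≡i = a≡i
... | no a≢i  = punchIn-punchOut a≢i

-- Meant for the colour `m` of an opposite edge: whenever it could complete a flag with `a`, it
-- becomes the leftover colour and so leaves the paired ones.
spare-color : ∀ {n} (a : Fin (suc (suc n))) (m : Maybe (Fin (suc (suc n)))) →
  ∃ λ c → c ≢ a × (∀ {b} → m ≡ just b → b ≢ a → b ≡ c)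
spare-color a nothing = punchIn a zero , punchInᵢ≢i a zero , λ ()
spare-color a (just b) with b ≟ᶠ a
... | yes b≡a = punchIn a zero , punchInᵢ≢i a zero , λ { refl b≢a → contradiction b≡a b≢a }
... | no b≢a  = b , b≢a , λ { refl _ → refl }

module Odd (h : ℕ) (φ : PartialColoring (suc (suc (suc (h + h))))) (φ-proper : IsProperPartial φ)
  (bounded : ∀ c → colorCount φ c ≤ suc (h + h)) where

  private
    N n d : ℕ
    N = suc (h + h)
    n = suc N
    d = suc n

  module _ (i₀ c₀ : Fin d) (free : ∀ v → φ (edgeAt v i₀) ≢ just c₀) where
    open Pairing φ φ-proper h {⊤} (insert i₀) (remove i₀) (insert-injective i₀) (insert-remove i₀)
      (insert c₀) (insert-injective c₀) (λ _ → free)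

    uncolored⇒avoidable : (∀ e → φ e ≡ nothing) → Avoidable φ
    uncolored⇒avoidable none = missed⇒avoidable bounded zero λ F _ → absurd F
      where
      absurd : ¬ Flag
      absurd F with trans (sym (none (Flag.e F))) (Flag.e-col F)
      ... | ()

    missed-flag⇒avoidable : ∀ e {a} → φ e ≡ just a → c₀ ≢ a → ∀ k →
      (∀ F → Flag.e F ≡ e → punchOut (Flag.i≢j F) ≢ k) → Avoidable φ
    missed-flag⇒avoidable e φe≡a c₀≢a k missed = missed⇒avoidable bounded (codeOf bounded e-col k)
      λ F eq → let (e≡ , k≡) = codeOf-injective bounded e-col (Flag.e-col F) eq in missed F (sym e≡) (sym k≡)
      where
      e-col : φ e ≡ just (insert c₀ (inj₁ (punchOut c₀≢a)))
      e-col = trans φe≡a (cong just (sym (punchIn-punchOut c₀≢a)))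

    colored-direction⇒avoidable : ∀ v {a} → φ (edgeAt v i₀) ≡ just a → Avoidable φ
    colored-direction⇒avoidable v eq = missed-flag⇒avoidable (edgeAt v i₀) eq
      (λ { refl → free v eq }) zero
      λ F e≡ _ → punchInᵢ≢i i₀ (Flag.i F) (trans (sym (Flag.e-dir F)) (cong direction e≡))

    -- The translation is along the first paired direction other than that of `e`, coded by `zero`.
    -- A flag there needs a paired colour other than `a` on the opposite edge, but `spare` forces
    -- that colour to be `c₀`, which is not paired.
    obstructed⇒avoidable : ∀ e {a} → φ e ≡ just a → (i₀≢i : i₀ ≢ direction e) → c₀ ≢ a →
      (∀ {b} → φ (translate e (punchIn i₀ (punchIn (punchOut i₀≢i) zero))) ≡ just b → b ≢ a → b ≡ c₀) →
      Avoidable φ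
    obstructed⇒avoidable e {a} φe≡a i₀≢i c₀≢a spare = missed-flag⇒avoidable e φe≡a c₀≢a zero impossible
      where
      impossible : ∀ F → Flag.e F ≡ e → punchOut (Flag.i≢j F) ≢ zero
      impossible F refl k≡0 = punchInᵢ≢i c₀ y
        (spare (trans (cong (λ j → φ (translate e (punchIn i₀ j))) j≡) opp-col)
          λ y≡a → x≢y (punchIn-injective c₀ x y (trans (just-injective (trans (sym e-col) φe≡a)) (sym y≡a))))
        where
        open Flag F hiding (e)
        i≡ : punchOut i₀≢i ≡ i
        i≡ = punchIn-injective i₀ _ _ (trans (punchIn-punchOut i₀≢i) e-dir)
        j≡ : punchIn (punchOut i₀≢i) zero ≡ j
        j≡ = trans (cong₂ punchIn i≡ (sym k≡0)) (punchIn-punchOut i≢j)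

  -- A colour occurring in all `d` directions would have `d` distinct edges, more than the `d` - 2
  -- allowed.
  free-direction : ∀ c → ∃ λ i → ∀ v → φ (edgeAt v i) ≢ just c
  free-direction c with search-Fin d (λ i → swap (search-Vertex d (λ v → has-color? φ (edgeAt v i) c)))
  ... | inj₂ found = found
  ... | inj₁ occurs = contradiction (≤-trans d≤ (bounded c)) (<⇒≱ (m<n⇒m<1+n (n<1+n N)))
    where
    d≤ : d ≤ colorCount φ c
    d≤ = injective⇒≤ {f = λ i → rank φ (proj₂ (occurs i))} λ {i} {j} eq →
      cong direction (rank-injective φ (proj₂ (occurs i)) (proj₂ (occurs j)) eq)

  -- If no edge of direction i₀ is coloured then every colour is admissible for i₀, and c₀ is
  -- chosen so that a fixed coloured edge and a fixed translate of it do not form a flag.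
  odd-case : Avoidable φ
  odd-case with free-direction zero
  ... | i₀ , free with search-Vertex d (λ v → colored? φ (edgeAt v i₀))
  ... | inj₂ (v , _ , eq) = colored-direction⇒avoidable i₀ zero free v eq
  ... | inj₁ empty with search-× (search-Vertex d) (search-Fin d) (λ (v , i) → colored? φ (edgeAt v i))
  ... | inj₁ none = uncolored⇒avoidable i₀ zero free λ e → trans (cong φ (sym (edgeAt-lower e))) (none _)
  ... | inj₂ ((v , i) , a , eq) =
    obstructed⇒avoidable i₀ c₀ (λ u eq′ → nothing≢just (trans (sym (empty u)) eq′)) (edgeAt v i) eq i₀≢i c₀≢a spare
    where
    nothing≢just : ∀ {c : Fin d} → nothing ≢ just c
    nothing≢just ()
    i₀≢i : i₀ ≢ i
    i₀≢i refl = nothing≢just (trans (sym (empty v)) eq)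
    choice = spare-color a (φ (translate (edgeAt v i) (punchIn i₀ (punchIn (punchOut i₀≢i) zero))))
    c₀ = proj₁ choice
    c₀≢a = proj₁ (proj₂ choice)
    spare = proj₂ (proj₂ choice)

parity : ∀ k → ∃ λ h → k ≡ h + h ⊎ k ≡ suc (h + h)
parity zero = 0 , inj₁ refl
parity (suc k) with parity k
... | h , inj₁ refl = h , inj₂ refl
... | h , inj₂ refl = suc h , inj₁ (cong suc (sym (+-suc h h)))

theorem4p11 : (d : ℕ) → 1 ≤ d → (φ : PartialColoring d) → IsProperPartial φ →
    (∀ (c : Fin d) → colorCount φ c + 2 ≤ d) → Avoidable φ
-- For d = 1 the bound would give 2 ≤ 1.
theorem4p11 (suc zero) _ φ proper few = contradiction (≤-trans (m≤n+m 2 _) (few zero)) λ { (s≤s ()) }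
theorem4p11 (suc (suc k)) _ φ proper few with parity k
... | h , inj₁ refl = even-case h φ proper λ c → m+n≤o⇒m≤o∸n (colorCount φ c) (few c)
... | h , inj₂ refl = Odd.odd-case h φ proper λ c → m+n≤o⇒m≤o∸n (colorCount φ c) (few c)
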